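{- Let $G$ be a finite, simple, connected graph with $\dim_{wt}(G)=2$. Then $G$ has no complete vertex of degree more than three.
   Context: $d(x,y)$ is the shortest-path distance. A vertex $v$ is a complete vertex if its neighborhood $N(v)$ induces a complete graph $K_{d(v)}$. A set $W\subseteq V(G)$ is a resolving set if for every two distinct vertices $y,z$ there is $x\in W$ with $d(y,x)\ne d(z,x)$. A set $W$ is a weak total resolving set (WTR-set) if $W$ is resolving and, for every $w\in W$ and every $x\in V(G)\setminus W$, there is $w'\in W\setminus\{w\}$ with $d(x,w')\ne d(w,w')$. $\dim_{wt}(G)$ is the minimum cardinality of a WTR-set. -}

module Defs where

open import Level using (Level; 0ℓ)
open import Data.Empty using (⊥-elim)
open import Data.Fin using (Fin; _≟_)
open import Data.Fin.Properties using (any?; all?)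
open import Data.Fin.Subset using (Subset; _∈_; _∉_; ∣_∣; ⊤)
open import Data.Fin.Subset.Properties using (_∈?_; anySubset?; ∈⊤)
open import Data.Nat using (ℕ; zero; suc; _≤_; z≤n; s≤s)
import Data.Nat as ℕ
open import Data.Product using (∃; ∃-syntax; _×_; _,_; proj₁; proj₂)
open import Data.Vec using (tabulate)
open import Function using (_∘_)
open import Relation.Binary using (Rel; Decidable; Irreflexive; Symmetric)
open import Relation.Binary.PropositionalEquality using (_≡_; _≢_; refl; trans)
  renaming (sym to ≡-sym)
open import Relation.Nullary using (Dec; yes; no; does; ¬?; _×-dec_; _→-dec_)
open import Relation.Nullary.Decidable using (map′)
open import Relation.Unary using (Pred) renaming (Decidable to Decidable₁)

private
  variable
    ℓ : Level
    n : ℕ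

IsLeast : Pred ℕ ℓ → Pred ℕ ℓ
IsLeast P k = P k × (∀ j → P j → k ≤ j)

least : {P : Pred ℕ ℓ} → Decidable₁ P → ∀ k → P k → ∃[ m ] IsLeast P m
least P? zero    p = zero , p , λ _ _ → z≤n
least P? (suc k) p with P? zero
... | yes p₀ = zero , p₀ , λ _ _ → z≤n
... | no ¬p₀ with least (P? ∘ suc) k p
...   | m , pm , min = suc m , pm ,
          λ { zero p₀ → ⊥-elim (¬p₀ p₀) ; (suc j) pj → s≤s (min j pj) }

record SimpleGraph (n : ℕ) : Set₁ where
  field
    Adj    : Rel (Fin n) 0ℓ
    adj?   : Decidable Adj
    sym    : Symmetric Adj
    irrefl : Irreflexive _≡_ Adj

module _ (G : SimpleGraph n) where
  open SimpleGraph G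

  N : Fin n → Subset n
  N v = tabulate (λ x → does (adj? v x))

  degree : Fin n → ℕ
  degree v = ∣ N v ∣

  CompleteVertex : Fin n → Set
  CompleteVertex v = ∀ x y → x ∈ N v → y ∈ N v → x ≢ y → Adj x y

  data Walk : Fin n → Fin n → ℕ → Set where
    []  : ∀ {x} → Walk x x 0
    _∷_ : ∀ {x y z k} → Adj x y → Walk y z k → Walk x z (suc k)

  walk? : ∀ x y k → Dec (Walk x y k)
  walk? x y zero = map′ (λ { refl → [] }) (λ { [] → refl }) (x ≟ y)
  walk? x z (suc k) =
    map′ (λ { (_ , e , w) → e ∷ w }) (λ { (e ∷ w) → _ , e , w })
         (any? λ y → adj? x y ×-dec walk? y z k)

  Connected : Set
  Connected = ∀ x y → ∃[ k ] Walk x y k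

module _ (G : SimpleGraph n) (conn : Connected G) where

  -- A walk of minimum length repeats no vertex, so minimising over walks
  -- gives the length of a shortest path.
  shortest : ∀ x y → ∃[ k ] IsLeast (Walk G x y) k
  shortest x y = least (walk? G x y) (proj₁ (conn x y)) (proj₂ (conn x y))

  d : Fin n → Fin n → ℕ
  d x y = proj₁ (shortest x y)

  Resolving : Subset n → Set
  Resolving W = ∀ y z → y ≢ z → ∃[ x ] (x ∈ W × d y x ≢ d z x)

  WeakTotalResolving : Subset n → Set
  WeakTotalResolving W =
    Resolving W ×
    (∀ w x → w ∈ W → x ∉ W → ∃[ w′ ] (w′ ∈ W × w′ ≢ w × d x w′ ≢ d w w′))

  resolving? : Decidable₁ Resolving
  resolving? W = all? λ y → all? λ z → ¬? (y ≟ z) →-dec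
    any? λ x → (x ∈? W) ×-dec ¬? (d y x ℕ.≟ d z x)

  weakTotalResolving? : Decidable₁ WeakTotalResolving
  weakTotalResolving? W = resolving? W ×-dec
    (all? λ w → all? λ x → (w ∈? W) →-dec (¬? (x ∈? W) →-dec
      any? λ w′ → (w′ ∈? W) ×-dec (¬? (w′ ≟ w) ×-dec ¬? (d x w′ ℕ.≟ d w w′))))

  d[x,x]≡0 : ∀ x → d x x ≡ 0
  d[x,x]≡0 x with d x x | proj₂ (proj₂ (shortest x x)) 0 []
  ... | zero | _ = refl

  d≡0⇒≡ : ∀ x y → d x y ≡ 0 → x ≡ y
  d≡0⇒≡ x y eq with d x y | proj₁ (proj₂ (shortest x y))
  d≡0⇒≡ x y refl | .0 | [] = refl

  -- Ensures that the minimum defining dim-wt is taken over a nonempty family.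
  ⊤-weakTotalResolving : WeakTotalResolving ⊤
  ⊤-weakTotalResolving =
    (λ y z y≢z → y , ∈⊤ , λ eq → y≢z (≡-sym (d≡0⇒≡ z y (lemma y z eq)))) ,
    (λ _ _ _ x∉⊤ → ⊥-elim (x∉⊤ ∈⊤))
    where
    lemma : ∀ y z → d y y ≡ d z y → d z y ≡ 0
    lemma y z eq = trans (≡-sym eq) (d[x,x]≡0 y)

  WTRSize : Pred ℕ 0ℓ
  WTRSize k = ∃[ W ] (WeakTotalResolving W × ∣ W ∣ ≡ k)

  wtrSize? : Decidable₁ WTRSize
  wtrSize? k = anySubset? λ W → weakTotalResolving? W ×-dec (∣ W ∣ ℕ.≟ k)

  minimumWTR : ∃[ k ] IsLeast WTRSize k
  minimumWTR = least wtrSize? ∣ ⊤ {n} ∣ (⊤ , ⊤-weakTotalResolving , refl)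

  dim-wt : ℕ
  dim-wt = proj₁ minimumWTR

{-# OPTIONS --safe #-}
-- The distances from two adjacent vertices to a landmark differ by at most one, so they
-- agree as soon as their parities do. On a clique, the vector of parities of the distances
-- to a resolving set W is therefore injective, whence a clique has at most 2 ^ ∣ W ∣ vertices.
-- A complete vertex of degree more than three yields a clique on at least five vertices.
module Submission where

open import Defs
open import Data.Nat using (ℕ; _>_)
open import Data.Product using (∃-syntax; _×_)
open import Relation.Nullary using (¬_)
open import Relation.Binary.PropositionalEquality using (_≡_)
open import Data.Bool using (true; false)
open import Data.Fin using (Fin; zero; suc; opposite; funToFin; finToFun)
open import Data.Fin.Properties
  using (suc-injective; opposite-involutive; finToFun-funToFin; pigeonhole; <⇒≢)
open import Data.Fin.Subset using (Subset; _∈_; ∣_∣)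
open import Data.Nat using (zero; suc; _≤_; _^_; s≤s)
open import Data.Nat.Properties using (≮⇒≥; <⇒≱)
open import Data.Product using (_,_; proj₁; proj₂)
open import Data.Vec using ([]; _∷_; here; there)
open import Data.Vec.Properties using ([]=⇒lookup; lookup∘tabulate)
open import Function using (_∘_)
open import Function.Definitions using (Injective)
open import Relation.Binary.PropositionalEquality
  using (_≢_; refl; sym; trans; cong; cong-app; subst)
open import Relation.Nullary using (yes; no; contradiction)

private
  variable
    m n : ℕ

-- Used twice: to index the neighbours of a complete vertex, and to index the landmarks that serve
-- as coordinates of `parityCode`.
enumerate : (p : Subset n) → Fin ∣ p ∣ → Fin n
enumerate (true  ∷ p) zero    = zero
enumerate (true  ∷ p) (suc i) = suc (enumerate p i)
enumerate (false ∷ p) i       = suc (enumerate p i)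

enumerate-∈ : (p : Subset n) (i : Fin ∣ p ∣) → enumerate p i ∈ p
enumerate-∈ (true  ∷ p) zero    = here
enumerate-∈ (true  ∷ p) (suc i) = there (enumerate-∈ p i)
enumerate-∈ (false ∷ p) i       = there (enumerate-∈ p i)

enumerate-injective : (p : Subset n) → Injective _≡_ _≡_ (enumerate p)
enumerate-injective (true  ∷ p) {zero}  {zero}  _  = refl
enumerate-injective (true  ∷ p) {suc i} {suc j} eq =
  cong suc (enumerate-injective p (suc-injective eq))
enumerate-injective (false ∷ p) eq = enumerate-injective p (suc-injective eq)

enumerate-surjective : (p : Subset n) {x : Fin n} → x ∈ p → ∃[ i ] enumerate p i ≡ x
enumerate-surjective (true  ∷ p) here = zero , refl
enumerate-surjective (true  ∷ p) (there x∈p) with enumerate-surjective p x∈p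
... | i , eq = suc i , cong suc eq
enumerate-surjective (false ∷ p) (there x∈p) with enumerate-surjective p x∈p
... | i , eq = i , cong suc eq

-- Valued in `Fin 2`, where `opposite` swaps the two elements, so that `funToFin` can pack a vector
-- of parities into `Fin (2 ^ k)`.
parity : ℕ → Fin 2
parity zero    = zero
parity (suc k) = opposite (parity k)

parity-injective-near : ∀ {j k} → j ≤ suc k → k ≤ suc j → parity j ≡ parity k → j ≡ k
parity-injective-near {zero}        {zero}        _         _         _  = refl
parity-injective-near {zero}        {suc zero}    _         _         ()
parity-injective-near {zero}        {suc (suc _)} _         (s≤s ())  _
parity-injective-near {suc zero}    {zero}        _         _         ()
parity-injective-near {suc (suc _)} {zero}        (s≤s ())  _         _
parity-injective-near {suc j}       {suc k}       (s≤s j≤k) (s≤s k≤j) eq =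
  cong suc (parity-injective-near j≤k k≤j
    -- `opposite` is an involution, so applying it to both sides of `eq` strips the outer
    -- `opposite`.
    (trans (sym (opposite-involutive (parity j)))
      (trans (cong opposite eq) (opposite-involutive (parity k)))))

module _ (G : SimpleGraph n) where
  open SimpleGraph G renaming (sym to Adj-sym)

  IsClique : (Fin m → Fin n) → Set
  IsClique c = ∀ i j → i ≢ j → Adj (c i) (c j)

  ∈N⇒Adj : ∀ {v x} → x ∈ N G v → Adj v x
  ∈N⇒Adj {v} {x} x∈N with adj? v x | trans (sym (lookup∘tabulate _ x)) ([]=⇒lookup x∈N)
  ... | yes v~x | _ = v~x
  ... | no  _   | ()

  -- Index `zero` is `v` itself. This extra vertex matters: degree four gives five clique vertices,
  -- one more than the `2 ^ 2` codes.
  closedNeighbourhood : ∀ v → Fin (suc (degree G v)) → Fin n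
  closedNeighbourhood v zero    = v
  closedNeighbourhood v (suc i) = enumerate (N G v) i

  closedNeighbourhood-clique : ∀ {v} → CompleteVertex G v → IsClique (closedNeighbourhood v)
  closedNeighbourhood-clique     _  zero    zero    i≢j = contradiction refl i≢j
  closedNeighbourhood-clique     _  zero    (suc j) _   = ∈N⇒Adj (enumerate-∈ (N G _) j)
  closedNeighbourhood-clique     _  (suc i) zero    _   =
    Adj-sym (∈N⇒Adj (enumerate-∈ (N G _) i))
  closedNeighbourhood-clique {v} cv (suc i) (suc j) i≢j =
    cv _ _ (enumerate-∈ (N G v) i) (enumerate-∈ (N G v) j)
      (i≢j ∘ cong suc ∘ enumerate-injective (N G v))

  module _ (conn : Connected G) where

    -- Prepending the edge to a shortest walk from `y` gives a walk from `x`, and `d` is minimal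
    -- among walk lengths.
    d-adj : ∀ {x y} z → Adj x y → d G conn x z ≤ suc (d G conn y z)
    d-adj {x} {y} z x~y =
      proj₂ (proj₂ (shortest G conn x z)) _ (x~y ∷ proj₁ (proj₂ (shortest G conn y z)))

    parityCode : (W : Subset n) → Fin n → Fin (2 ^ ∣ W ∣)
    parityCode W x = funToFin (λ i → parity (d G conn x (enumerate W i)))

    -- `finToFun` decodes the packed vector, and the landmark `w` is read off at its index in
    -- `enumerate W`.
    parityCode-≡ : ∀ W {x y} → parityCode W x ≡ parityCode W y →
                   ∀ {w} → w ∈ W → parity (d G conn x w) ≡ parity (d G conn y w)
    parityCode-≡ W eq w∈W with enumerate-surjective W w∈W
    ... | i , refl = trans (sym (finToFun-funToFin _ i))
                       (trans (cong-app (cong finToFun eq) i) (finToFun-funToFin _ i))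

    clique-≤-2^resolving : ∀ {W} → Resolving G conn W →
                           {c : Fin m → Fin n} → IsClique c → m ≤ 2 ^ ∣ W ∣
    clique-≤-2^resolving {W = W} resolving {c} clique = ≮⇒≥ λ 2^∣W∣<m →
      let i , j , i<j , sameCode = pigeonhole 2^∣W∣<m (parityCode W ∘ c)
          cᵢ~cⱼ = clique i j (<⇒≢ i<j)
          -- Distinct indices give adjacent, hence distinct, vertices, so some landmark must
          -- separate them.
          w , w∈W , dᵢ≢dⱼ = resolving (c i) (c j) (λ eq → irrefl eq cᵢ~cⱼ)
      in dᵢ≢dⱼ (parity-injective-near (d-adj w cᵢ~cⱼ) (d-adj w (Adj-sym cᵢ~cⱼ))
                 (parityCode-≡ W sameCode w∈W))

theorem3 : ∀ {n : ℕ} (G : SimpleGraph n) (conn : Connected G) →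
    dim-wt G conn ≡ 2 →
    ¬ (∃[ v ] (CompleteVertex G v × degree G v > 3))
theorem3 G conn dim≡2 (v , complete , deg>3) with minimumWTR G conn
theorem3 G conn refl (v , complete , deg>3) | _ , (W , (resolving , _) , ∣W∣≡2) , _ =
  -- Matching on `minimumWTR` exposes a set `W` attaining the minimum 2. The clique has more than 4
  -- vertices, while the bound `2 ^ 2` evaluates to 4.
  <⇒≱ (s≤s deg>3)
    (subst (λ k → suc (degree G v) ≤ 2 ^ k) ∣W∣≡2
      (clique-≤-2^resolving G conn resolving (closedNeighbourhood-clique G complete)))
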